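{- For any integer $n\geq 1$ and complex numbers $a,x$ (with $axq^k\neq 1$ for $0\le k\le n-1$), $$\sum_{k=1}^n k\left[{n \atop k}\right]_q q^{\binom{k}{2}} (-ax)^{k-1}=(ax; q)_n \sum_{k=0}^{n-1} \frac{q^k }{1-a x q^k}.$$
   Context: $q$ is a complex number with $0<|q|<1$. For an integer $n\ge 0$, $(a;q)_n=\prod_{j=0}^{n-1}(1-aq^j)$, and the $q$-binomial coefficient is $\left[{n\atop k}\right]_q=\frac{(q;q)_n}{(q;q)_k(q;q)_{n-k}}$. The convention $0^0=1$ is used. -}

module Defs where

open import Algebra.Bundles using (CommutativeRing; Semiring)
open import Data.Empty using (⊥-elim)
open import Data.Fin.Base using (Fin; zero; suc; toℕ)
import Data.Integer.Base as ℤ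
import Data.Integer.Properties as ℤ
open import Data.Nat.Base as ℕ using (ℕ; zero; suc; _∸_)
import Data.Nat.Properties as ℕ
open import Data.Product.Base using (∃-syntax; _×_; _,_; proj₁; proj₂)
open import Data.Rational.Base as ℚ using (ℚ; mkℚ; 0ℚ; 1ℚ; ½; *≤*; *<*)
open import Data.Rational.Literals using (fromℤ)
import Data.Rational.Properties as ℚ
open import Data.Rational.Solver using (module +-*-Solver)
import Data.Rational.Unnormalised.Base as ℚᵘ
import Data.Rational.Unnormalised.Properties as ℚᵘ
open import Data.Sum.Base using (inj₁; inj₂)
open import Level using (0ℓ)
open import Algebra.Structures using (IsMonoid; IsAbelianGroup; IsCommutativeRing)
open import Relation.Binary.Structures using (IsEquivalence)
open import Relation.Binary.PropositionalEquality.Core using (_≡_; refl; sym; trans; cong; cong₂; subst; subst₂)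
open import Relation.Nullary.Decidable.Core using (yes; no)

module Rationals where

  open import Data.Rational.Base hiding (ℚ; mkℚ; 0ℚ; 1ℚ; ½; *≤*; *<*)
  open +-*-Solver

  nonneg-diff : ∀ {p q} → p ≤ q → 0ℚ ≤ q - p
  nonneg-diff {p} {q} p≤q =
    subst (_≤ q - p) (ℚ.+-inverseʳ p) (ℚ.+-monoˡ-≤ (- p) p≤q)

  diff-nonneg : ∀ {p q d} → d ≡ q - p → 0ℚ ≤ d → p ≤ q
  diff-nonneg {p} {q} refl h =
    subst₂ _≤_ (ℚ.+-identityˡ p)
      (solve 2 (λ p q → (q :- p) :+ p := q) refl p q)
      (ℚ.+-monoˡ-≤ p h)

  0≤+ : ∀ {p q} → 0ℚ ≤ p → 0ℚ ≤ q → 0ℚ ≤ p + q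
  0≤+ = ℚ.+-mono-≤

  0≤* : ∀ {p q} → 0ℚ ≤ p → 0ℚ ≤ q → 0ℚ ≤ p * q
  0≤* {p} {q} 0≤p 0≤q = ℚ.nonNegative⁻¹ (p * q)
    {{ℚ.nonNeg*nonNeg⇒nonNeg p {{nonNegative 0≤p}} q {{nonNegative 0≤q}}}}

  0<* : ∀ {p q} → 0ℚ < p → 0ℚ < q → 0ℚ < p * q
  0<* {p} {q} 0<p 0<q = ℚ.positive⁻¹ (p * q)
    {{ℚ.pos*pos⇒pos p {{positive 0<p}} q {{positive 0<q}}}}

  0≤sq : ∀ p → 0ℚ ≤ p * p
  0≤sq p with ℚ.≤-total 0ℚ p
  ... | inj₁ 0≤p = 0≤* 0≤p 0≤p
  ... | inj₂ p≤0 = subst (0ℚ ≤_) (solve 1 (λ p → (:- p) :* (:- p) := p :* p) refl p)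
                     (0≤* (ℚ.neg-antimono-≤ p≤0) (ℚ.neg-antimono-≤ p≤0))

  0<½ : ∀ {p} → 0ℚ < p → 0ℚ < ½ * p
  0<½ = 0<* (ℚ.positive⁻¹ ½)

  ½+½ : ∀ p → ½ * p + ½ * p ≡ p
  ½+½ = solve 1 (λ p → con ½ :* p :+ con ½ :* p := p) refl

  *-mono-≤ : ∀ {p q r s} → 0ℚ ≤ r → 0ℚ ≤ q → p ≤ q → r ≤ s → p * r ≤ q * s
  *-mono-≤ {p} {q} {r} {s} 0≤r 0≤q p≤q r≤s = diff-nonneg
    (solve 4 (λ p q r s → (q :- p) :* r :+ q :* (s :- r) := q :* s :- p :* r) refl p q r s)
    (0≤+ (0≤* (nonneg-diff p≤q) 0≤r) (0≤* 0≤q (nonneg-diff r≤s)))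

  abs-≤ : ∀ {p e} → p ≤ e → - p ≤ e → ∣ p ∣ ≤ e
  abs-≤ {p} {e} h₁ h₂ with ℚ.∣p∣≡p∨∣p∣≡-p p
  ... | inj₁ eq = subst (_≤ e) (sym eq) h₁
  ... | inj₂ eq = subst (_≤ e) (sym eq) h₂

  ≤-abs : ∀ p → p ≤ ∣ p ∣
  ≤-abs p with ℚ.≤-total 0ℚ p
  ... | inj₁ 0≤p = ℚ.≤-reflexive (sym (ℚ.0≤p⇒∣p∣≡p 0≤p))
  ... | inj₂ p≤0 = ℚ.≤-trans p≤0 (ℚ.0≤∣p∣ p)

  abs-sym : ∀ p q → ∣ p - q ∣ ≡ ∣ q - p ∣
  abs-sym p q = trans (sym (ℚ.∣-p∣≡∣p∣ (p - q)))
    (cong ∣_∣ (solve 2 (λ p q → :- (p :- q) := q :- p) refl p q))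

  abs-triangle : ∀ p q r → ∣ p - r ∣ ≤ ∣ p - q ∣ + ∣ q - r ∣
  abs-triangle p q r = subst (λ t → ∣ t ∣ ≤ ∣ p - q ∣ + ∣ q - r ∣)
    (solve 3 (λ p q r → (p :- q) :+ (q :- r) := p :- r) refl p q r)
    (ℚ.∣p+q∣≤∣p∣+∣q∣ (p - q) (q - r))

  abs-diff-abs : ∀ p q → ∣ ∣ p ∣ - ∣ q ∣ ∣ ≤ ∣ p - q ∣
  abs-diff-abs p q = abs-≤ (half p q)
    (subst₂ _≤_ (solve 2 (λ p q → q :- p := :- (p :- q)) refl (∣ p ∣) (∣ q ∣))
      (abs-sym q p) (half q p))
    where
    half : ∀ p q → ∣ p ∣ - ∣ q ∣ ≤ ∣ p - q ∣
    half p q = diff-nonneg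
      (solve 3 (λ d p q → (d :+ q) :- p := d :- (p :- q)) refl (∣ p - q ∣) (∣ p ∣) (∣ q ∣))
      (nonneg-diff (subst (λ t → ∣ t ∣ ≤ ∣ p - q ∣ + ∣ q ∣)
        (solve 2 (λ p q → (p :- q) :+ q := p) refl p q)
        (ℚ.∣p+q∣≤∣p∣+∣q∣ (p - q) q)))

  ι : ℕ → ℚ
  ι n = fromℤ (ℤ.+ n)

  δ : ℕ → ℚ
  δ n = 1/ ι (suc n)

  ι-suc : ∀ n → ι (suc n) ≡ 1ℚ + ι n
  ι-suc n = ℚ.toℚᵘ-injective (ℚᵘ.≃-trans
    (ℚᵘ.*≡* (cong (λ k → (ℤ.+ 1 ℤ.+ k) ℤ.* ℤ.+ 1) (sym (ℤ.*-identityʳ (ℤ.+ n)))))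
    (ℚᵘ.≃-sym (ℚ.toℚᵘ-homo-+ 1ℚ (ι n))))

  ι-* : ∀ m n → ι (m ℕ.* n) ≡ ι m * ι n
  ι-* m n = ℚ.toℚᵘ-injective (ℚᵘ.≃-trans
    (ℚᵘ.*≡* (cong (ℤ._* ℤ.+ 1) (ℤ.pos-* m n)))
    (ℚᵘ.≃-sym (ℚ.toℚᵘ-homo-* (ι m) (ι n))))

  0≤ι : ∀ n → 0ℚ ≤ ι n
  0≤ι n = ℚ.nonNegative⁻¹ (ι n)

  0<δ : ∀ n → 0ℚ < δ n
  0<δ n = ℚ.positive⁻¹ (δ n)

  δ-small : ∀ {e} → 0ℚ < e → ∃[ N ] ∀ n → N ℕ.≤ n → δ n ≤ e
  δ-small {mkℚ (ℤ.+ suc a) d _} _ = d , λ n d≤n → *≤* (ℤ.+≤+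
    (ℕ.≤-trans (ℕ.≤-reflexive (ℕ.*-identityˡ (suc d)))
      (ℕ.≤-trans (ℕ.s≤s d≤n) (ℕ.m≤n*m (suc n) (suc a)))))
  δ-small {mkℚ (ℤ.+ zero) d _} (*<* (ℤ.+<+ ()))
  δ-small {mkℚ ℤ.-[1+ a ] d _} (*<* ())

  <ι : ∀ p → p < ι (suc ℤ.∣ ↥ p ∣)
  <ι (mkℚ (ℤ.+ a) d _) = *<* (subst₂ ℤ._<_ (ℤ.pos-* a 1) (ℤ.pos-* (suc a) (suc d)) (ℤ.+<+ (ℕ.s≤s
    (ℕ.≤-trans (ℕ.≤-reflexive (ℕ.*-identityʳ a))
      (ℕ.≤-trans (ℕ.m≤m*n a (suc d)) (ℕ.m≤n+m (a ℕ.* suc d) d))))))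
  <ι (mkℚ ℤ.-[1+ a ] d _) = *<* ℤ.-<+

  -- Starting from s, take at most k steps of length e for as long as the
  -- square stays below p.
  climb : ℚ → ℚ → ℕ → ℚ → ℚ
  climb e p zero    s = s
  climb e p (suc k) s with (s + e) * (s + e) ℚ.≤? p
  ... | yes _ = climb e p k (s + e)
  ... | no  _ = s

  -- The largest multiple of 1/(n+1) whose square is at most ∣p∣.
  sqrt : ℕ → ℚ → ℚ
  sqrt n p = climb (δ n) ∣ p ∣ (suc n ℕ.* suc ℤ.∣ ↥ p ∣) 0ℚ

  record Root (e p s : ℚ) : Set where
    field
      nonneg : 0ℚ ≤ s
      lower  : s * s ≤ p
      upper  : p < (s + e) * (s + e)

  climb-root : ∀ e p k s → 0ℚ ≤ e → 0ℚ ≤ s → s * s ≤ p →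
    p < (s + ι (suc k) * e) * (s + ι (suc k) * e) → Root e p (climb e p k s)
  climb-root e p zero s 0≤e 0≤s lo hi = record
    { nonneg = 0≤s ; lower = lo
    ; upper = subst (λ t → p < (s + t) * (s + t)) (ℚ.*-identityˡ e) hi }
  climb-root e p (suc k) s 0≤e 0≤s lo hi with (s + e) * (s + e) ℚ.≤? p
  ... | yes h = climb-root e p k (s + e) 0≤e (0≤+ 0≤s 0≤e) h
        (subst (λ t → p < t * t)
          (trans (cong (λ t → s + t * e) (ι-suc (suc k)))
            (solve 3 (λ s e k → s :+ (con 1ℚ :+ k) :* e := (s :+ e) :+ k :* e) refl s e (ι (suc k))))
          hi)
  ... | no ¬h = record { nonneg = 0≤s ; lower = lo ; upper = ℚ.≰⇒> ¬h }

  sqrt-root : ∀ n p → Root (δ n) ∣ p ∣ (sqrt n p)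
  sqrt-root n p@record{} = climb-root (δ n) ∣ p ∣ (suc n ℕ.* suc c) 0ℚ
    (ℚ.<⇒≤ (0<δ n)) ℚ.≤-refl (ℚ.0≤∣p∣ p)
    (ℚ.<-≤-trans (<ι ∣ p ∣) (ℚ.≤-trans C≤x x≤x²))
    where
    c = ℤ.∣ ↥ p ∣
    C = ι (suc c)
    x = 0ℚ + ι (suc (suc n ℕ.* suc c)) * δ n
    x-eq : x ≡ δ n + C
    x-eq = trans (cong (λ t → 0ℚ + t * δ n)
             (trans (ι-suc (suc n ℕ.* suc c)) (cong (1ℚ +_) (ι-* (suc n) (suc c)))))
           (trans (solve 3 (λ d N C → con 0ℚ :+ (con 1ℚ :+ N :* C) :* d := d :+ (N :* d) :* C)
                    refl (δ n) (ι (suc n)) C)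
             (cong (δ n +_) (trans (cong (_* C) (ℚ.*-inverseʳ (ι (suc n)))) (ℚ.*-identityˡ C))))
    C≤x : C ≤ x
    C≤x = diff-nonneg (trans (solve 2 (λ d C → d := (d :+ C) :- C) refl (δ n) C) (cong (_- C) (sym x-eq)))
            (ℚ.<⇒≤ (0<δ n))
    1≤C : 1ℚ ≤ C
    1≤C = diff-nonneg (trans (solve 1 (λ c → c := (con 1ℚ :+ c) :- con 1ℚ) refl (ι c))
            (cong (_- 1ℚ) (sym (ι-suc c)))) (0≤ι c)
    x≤x² : x ≤ x * x
    x≤x² = diff-nonneg (solve 1 (λ x → (x :- con 1ℚ) :* x := x :* x :- x) refl x)
      (0≤* (nonneg-diff (ℚ.≤-trans 1≤C C≤x)) (ℚ.≤-trans (0≤ι (suc c)) C≤x))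

  sqrt-close : ∀ {a b s t d e h} → 0ℚ ≤ e → Root d a s → Root e b t → e ≤ h → a - b ≤ h * h → s ≤ t + (h + h)
  sqrt-close {a} {b} {s} {t} {d} {e} {h} 0≤e S T e≤h a-b≤ with s ℚ.≤? t + (h + h)
  ... | yes s≤ = s≤
  ... | no s≰ = ⊥-elim (ℚ.<-irrefl refl (ℚ.<-≤-trans (Root.upper T) (ℚ.≤-trans t+e≤ chain)))
    where
    0≤h = ℚ.≤-trans 0≤e e≤h
    0≤t = Root.nonneg T
    t+e≤ : (t + e) * (t + e) ≤ (t + h) * (t + h)
    t+e≤ = *-mono-≤ (0≤+ 0≤t 0≤e) (0≤+ 0≤t 0≤h) (ℚ.+-monoʳ-≤ t e≤h) (ℚ.+-monoʳ-≤ t e≤h)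
    0≤t+2h = 0≤+ 0≤t (0≤+ 0≤h 0≤h)
    t+2h≤s = ℚ.<⇒≤ (ℚ.≰⇒> s≰)
    big : (t + (h + h)) * (t + (h + h)) ≤ a
    big = ℚ.≤-trans (*-mono-≤ 0≤t+2h (Root.nonneg S) t+2h≤s t+2h≤s) (Root.lower S)
    chain : (t + h) * (t + h) ≤ b
    chain = diff-nonneg
      (solve 4 (λ t h a b →
          (a :- (t :+ (h :+ h)) :* (t :+ (h :+ h))) :+ (h :* h :- (a :- b)) :+ ((t :+ t) :* h :+ (h :+ h) :* h)
          := b :- (t :+ h) :* (t :+ h)) refl t h a b)
      (0≤+ (0≤+ (nonneg-diff big) (nonneg-diff a-b≤))
           (0≤+ (0≤* (0≤+ 0≤t 0≤t) 0≤h) (0≤* (0≤+ 0≤h 0≤h) 0≤h)))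

  sqrt-lower : ∀ {d p s e} → Root d p s → 0ℚ ≤ e → e ≤ s → e * e ≤ p
  sqrt-lower R 0≤e e≤s = ℚ.≤-trans (*-mono-≤ 0≤e (Root.nonneg R) e≤s e≤s) (Root.lower R)

  sqrt-below-1 : ∀ {d p s h} → 0ℚ ≤ d → Root d p s → 0ℚ ≤ h → d ≤ h → s + (h + h) ≤ 1ℚ → p + h ≤ 1ℚ
  sqrt-below-1 {d} {p} {s} {h} 0≤d R 0≤h d≤h s≤ = diff-nonneg
    (solve 4 (λ p s d h →
        ((s :+ d) :* (s :+ d) :- p)
        :+ (((con 1ℚ :- (s :+ (h :+ h))) :+ (h :- d)) :* ((s :+ d) :+ (con 1ℚ :- h))
        :+ h :* (con 1ℚ :- h))
        := con 1ℚ :- (p :+ h)) refl p s d h)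
    (0≤+ (nonneg-diff (ℚ.<⇒≤ (Root.upper R)))
      (0≤+ (0≤* (0≤+ (nonneg-diff s≤) (nonneg-diff d≤h)) (0≤+ (0≤+ 0≤s 0≤d) 0≤1-h)) (0≤* 0≤h 0≤1-h)))
    where
    0≤s = Root.nonneg R
    0≤1-h : 0ℚ ≤ 1ℚ - h
    0≤1-h = subst (0ℚ ≤_)
      (solve 2 (λ s h → (con 1ℚ :- (s :+ (h :+ h))) :+ (s :+ h) := con 1ℚ :- h) refl s h)
      (0≤+ (nonneg-diff s≤) (0≤+ 0≤s 0≤h))

  sqrt-above : ∀ {d p s c e} → Root d p s → 0ℚ ≤ d → 0ℚ ≤ e → d ≤ e → e + e ≤ 1ℚ → e + e ≤ c → c ≤ p → e ≤ s
  sqrt-above {d} {p} {s} {c} {e} R 0≤d 0≤e d≤e e+e≤1 e+e≤c c≤p with e ℚ.≤? s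
  ... | yes e≤s = e≤s
  ... | no e≰s = ⊥-elim (ℚ.<-irrefl refl (ℚ.<-≤-trans (Root.upper R)
      (ℚ.≤-trans (*-mono-≤ (0≤+ (Root.nonneg R) 0≤d) (ℚ.≤-trans 0≤s+d s+d≤) s+d≤ s+d≤)
        (ℚ.≤-trans sq≤ (ℚ.≤-trans e+e≤c c≤p)))))
    where
    0≤s+d = 0≤+ (Root.nonneg R) 0≤d
    s+d≤ : s + d ≤ e + e
    s+d≤ = ℚ.+-mono-≤ (ℚ.<⇒≤ (ℚ.≰⇒> e≰s)) d≤e
    sq≤ : (e + e) * (e + e) ≤ e + e
    sq≤ = diff-nonneg (solve 1 (λ x → x :* (con 1ℚ :- x) := x :- x :* x) refl (e + e))
      (0≤* (0≤+ 0≤e 0≤e) (nonneg-diff e+e≤1))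

  -- Only used at nonzero arguments; the value at 0 is irrelevant.
  recip : ℚ → ℚ
  recip p with p ℚ.≟ 0ℚ
  ... | yes _   = 0ℚ
  ... | no p≢0 = (1/ p) {{≢-nonZero p≢0}}

  recip-inverse : ∀ {p} → 0ℚ < p → p * recip p ≡ 1ℚ
  recip-inverse {p} 0<p with p ℚ.≟ 0ℚ
  ... | yes p≡0 = ⊥-elim (ℚ.<-irrefl (sym p≡0) 0<p)
  ... | no p≢0 = ℚ.*-inverseʳ p {{≢-nonZero p≢0}}

  recip-nonneg : ∀ {p} → 0ℚ < p → 0ℚ ≤ recip p
  recip-nonneg {p} 0<p = subst (0ℚ ≤_)
    (trans (solve 2 (λ p r → p :* (r :* r) := (p :* r) :* r) refl p (recip p))
      (trans (cong (_* recip p) (recip-inverse 0<p)) (ℚ.*-identityˡ (recip p))))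
    (0≤* (ℚ.<⇒≤ 0<p) (0≤sq (recip p)))

  recip-pos : ∀ {p} → 0ℚ < p → 0ℚ < recip p
  recip-pos {p} 0<p with p ℚ.≟ 0ℚ
  ... | yes p≡0 = ⊥-elim (ℚ.<-irrefl (sym p≡0) 0<p)
  ... | no _ = ℚ.positive⁻¹ _ {{ℚ.1/pos⇒pos p {{positive 0<p}}}}

  recip-diff : ∀ {c p q e} → 0ℚ < c → c ≤ p → c ≤ q → ∣ p - q ∣ ≤ e * (c * c) → 0ℚ ≤ e →
    ∣ recip p - recip q ∣ ≤ e
  recip-diff {c} {p} {q} {e} 0<c c≤p c≤q h 0≤e = begin
    ∣ r - s ∣                ≡⟨ cong ∣_∣ eq ⟩
    ∣ (q - p) * (r * s) ∣     ≡⟨ ℚ.∣p*q∣≡∣p∣*∣q∣ (q - p) (r * s) ⟩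
    ∣ q - p ∣ * ∣ r * s ∣     ≡⟨ cong₂ _*_ (abs-sym q p) (ℚ.0≤p⇒∣p∣≡p 0≤rs) ⟩
    ∣ p - q ∣ * (r * s)      ≤⟨ *-mono-≤ 0≤rs (0≤* 0≤e (0≤* 0≤c 0≤c)) h ℚ.≤-refl ⟩
    (e * (c * c)) * (r * s)  ≡⟨ solve 4 (λ e c r s → (e :* (c :* c)) :* (r :* s) := e :* ((c :* r) :* (c :* s))) refl e c r s ⟩
    e * ((c * r) * (c * s))  ≤⟨ *-mono-≤ (0≤* (0≤* 0≤c 0≤r) (0≤* 0≤c 0≤s)) 0≤e ℚ.≤-refl
                                 (*-mono-≤ (0≤* 0≤c 0≤s) (ℚ.nonNegative⁻¹ 1ℚ) (le c≤p 0<p) (le c≤q 0<q)) ⟩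
    e * (1ℚ * 1ℚ)            ≡⟨ ℚ.*-identityʳ e ⟩
    e                        ∎
    where
    open ℚ.≤-Reasoning
    r = recip p
    s = recip q
    0≤c = ℚ.<⇒≤ 0<c
    0<p = ℚ.<-≤-trans 0<c c≤p
    0<q = ℚ.<-≤-trans 0<c c≤q
    0≤r = recip-nonneg 0<p
    0≤s = recip-nonneg 0<q
    0≤rs = 0≤* 0≤r 0≤s
    le : ∀ {t} → c ≤ t → 0ℚ < t → c * recip t ≤ 1ℚ
    le {t} c≤t 0<t = subst (c * recip t ≤_) (recip-inverse 0<t)
      (*-mono-≤ (recip-nonneg 0<t) (ℚ.<⇒≤ 0<t) c≤t ℚ.≤-refl)
    eq : r - s ≡ (q - p) * (r * s)
    eq = trans (sym (trans (cong₂ (λ u v → r * u - s * v) (recip-inverse 0<q) (recip-inverse 0<p))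
                 (cong₂ _-_ (ℚ.*-identityʳ r) (ℚ.*-identityʳ s))))
               (solve 4 (λ p q r s → r :* (q :* s) :- s :* (p :* r) := (q :- p) :* (r :* s)) refl p q r s)

open Rationals using (sqrt; recip)

-- For f = g this is the Cauchy condition; for Cauchy sequences f and g it says
-- that f n − g n tends to 0.
infix 4 _∼_
_∼_ : (f g : ℕ → ℚ) → Set
f ∼ g = ∀ ε → 0ℚ ℚ.< ε → ∃[ N ] ∀ m n → N ℕ.≤ m → N ℕ.≤ n → ℚ.∣ f m ℚ.- g n ∣ ℚ.≤ ε

record ℝ : Set where
  constructor mkℝ
  field
    seq    : ℕ → ℚ
    cauchy : seq ∼ seq

open ℝ

module Sequences where

  open import Data.Rational.Base hiding (ℚ; mkℚ; 0ℚ; 1ℚ; ½; *≤*; *<*)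
  open +-*-Solver
  open Rationals

  private
    left : ∀ {M N k} → M ℕ.⊔ N ℕ.≤ k → M ℕ.≤ k
    left {M} {N} = ℕ.m⊔n≤o⇒m≤o M N

    right : ∀ {M N k} → M ℕ.⊔ N ℕ.≤ k → N ℕ.≤ k
    right {M} {N} = ℕ.m⊔n≤o⇒n≤o M N

  Eventually : (ℕ → Set) → Set
  Eventually P = ∃[ N ] ∀ n → N ℕ.≤ n → P n

  both : ∀ {P Q R : ℕ → Set} → (∀ {n} → P n → Q n → R n) → Eventually P → Eventually Q → Eventually R
  both f (M , p) (N , q) = M ℕ.⊔ N , λ n h → f (p n (left h)) (q n (right {M} h))

  -- Abstract so that comparing two reals never unfolds their moduli of convergence.
  abstract
    ∼-sym : ∀ {f g} → f ∼ g → g ∼ f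
    ∼-sym {f} {g} h ε 0<ε with h ε 0<ε
    ... | N , k = N , λ m n N≤m N≤n → subst (_≤ ε) (abs-sym (f n) (g m)) (k n m N≤n N≤m)

    ∼-trans : ∀ {f g h} → f ∼ g → g ∼ h → f ∼ h
    ∼-trans {f} {g} {h} p q ε 0<ε with p (½ * ε) (0<½ 0<ε) | q (½ * ε) (0<½ 0<ε)
    ... | M , u | N , v = M ℕ.⊔ N , λ m n hm hn →
      ℚ.≤-trans (abs-triangle (f m) (g (M ℕ.⊔ N)) (h n))
        (subst (∣ f m - g (M ℕ.⊔ N) ∣ + ∣ g (M ℕ.⊔ N) - h n ∣ ≤_) (½+½ ε)
          (ℚ.+-mono-≤ (u m (M ℕ.⊔ N) (left hm) (ℕ.m≤m⊔n M N))
                      (v (M ℕ.⊔ N) n (ℕ.m≤n⊔m M N) (right {M} hn))))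

    ∼-pointwise : ∀ {f g} → f ∼ f → (∀ n → f n ≡ g n) → f ∼ g
    ∼-pointwise {f} h eq ε 0<ε with h ε 0<ε
    ... | N , k = N , λ m n hm hn → subst (λ t → ∣ f m - t ∣ ≤ ε) (eq n) (k m n hm hn)

    ∼-eventually : ∀ {f g} → f ∼ f → Eventually (λ n → f n ≡ g n) → f ∼ g
    ∼-eventually {f} h (M , eq) ε 0<ε with h ε 0<ε
    ... | N , k = M ℕ.⊔ N , λ m n hm hn →
      subst (λ t → ∣ f m - t ∣ ≤ ε) (eq n (left hn)) (k m n (right {M} hm) (right {M} hn))

    const-∼ : ∀ p → (λ _ → p) ∼ (λ _ → p)
    const-∼ p ε 0<ε = 0 , λ _ _ _ _ → subst (λ t → ∣ t ∣ ≤ ε) (sym (ℚ.+-inverseʳ p)) (ℚ.<⇒≤ 0<ε)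

    +-∼ : ∀ {f f′ g g′} → f ∼ f′ → g ∼ g′ → (λ n → f n + g n) ∼ (λ n → f′ n + g′ n)
    +-∼ {f} {f′} {g} {g′} p q ε 0<ε with p (½ * ε) (0<½ 0<ε) | q (½ * ε) (0<½ 0<ε)
    ... | M , u | N , v = M ℕ.⊔ N , λ m n hm hn →
      subst₂ _≤_
        (cong ∣_∣ (solve 4 (λ a a′ b b′ → (a :- a′) :+ (b :- b′) := (a :+ b) :- (a′ :+ b′)) refl (f m) (f′ n) (g m) (g′ n)))
        (½+½ ε)
        (ℚ.≤-trans (ℚ.∣p+q∣≤∣p∣+∣q∣ (f m - f′ n) (g m - g′ n))
          (ℚ.+-mono-≤ (u m n (left hm) (left hn)) (v m n (right {M} hm) (right {M} hn))))

    neg-∼ : ∀ {f f′} → f ∼ f′ → (λ n → - f n) ∼ (λ n → - f′ n)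
    neg-∼ {f} {f′} p ε 0<ε with p ε 0<ε
    ... | N , u = N , λ m n hm hn → subst (_≤ ε)
      (trans (abs-sym (f m) (f′ n)) (cong ∣_∣ (solve 2 (λ a b → b :- a := (:- a) :- (:- b)) refl (f m) (f′ n))))
      (u m n hm hn)

    bounded : ∀ {f g} → f ∼ g → ∃[ B ] 0ℚ < B × Eventually (λ n → ∣ f n ∣ ≤ B)
    bounded {f} {g} h with h 1ℚ (ℚ.positive⁻¹ 1ℚ)
    ... | N , k = 1ℚ + ∣ g N ∣ , ℚ.+-mono-<-≤ (ℚ.positive⁻¹ 1ℚ) (ℚ.0≤∣p∣ (g N))
      , N , λ n hn → ℚ.≤-trans
        (subst (λ t → ∣ t ∣ ≤ ∣ f n - g N ∣ + ∣ g N ∣)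
          (solve 2 (λ a b → (a :- b) :+ b := a) refl (f n) (g N))
          (ℚ.∣p+q∣≤∣p∣+∣q∣ (f n - g N) (g N)))
        (ℚ.+-monoˡ-≤ ∣ g N ∣ (k n N hn ℕ.≤-refl))

    *-∼ : ∀ {f f′ g g′} → f ∼ f′ → g ∼ g′ → (λ n → f n * g n) ∼ (λ n → f′ n * g′ n)
    *-∼ {f} {f′} {g} {g′} p q ε 0<ε =
      let B , 0<B , bB = bounded {f} {f′} p
          C , 0<C , bC = bounded {g′} {g} (∼-sym {g} {g′} q)
          η , 0<η , Bη+ηC≡ε = split 0<B 0<C 0<ε
      in combine 0<B 0<η Bη+ηC≡ε bB bC (p η 0<η) (q η 0<η)
      where
      split : ∀ {B C e} → 0ℚ < B → 0ℚ < C → 0ℚ < e → ∃[ η ] 0ℚ < η × B * η + η * C ≡ e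
      split {B} {C} {e} 0<B 0<C 0<e = e * recip (B + C) , 0<* 0<e (recip-pos 0<S) ,
        trans (solve 4 (λ B C e r → B :* (e :* r) :+ (e :* r) :* C := e :* ((B :+ C) :* r)) refl B C e (recip (B + C)))
          (trans (cong (e *_) (recip-inverse 0<S)) (ℚ.*-identityʳ e))
        where
        0<S : 0ℚ < B + C
        0<S = ℚ.+-mono-< 0<B 0<C
      estimate : ∀ {a a′ b b′ B C η e} → 0ℚ < B → 0ℚ < η → B * η + η * C ≡ e →
        ∣ a ∣ ≤ B → ∣ b′ ∣ ≤ C → ∣ a - a′ ∣ ≤ η → ∣ b - b′ ∣ ≤ η → ∣ a * b - a′ * b′ ∣ ≤ e
      estimate {a} {a′} {b} {b′} {B} {C} {η} {e} 0<B 0<η eq aB bC da db = begin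
        ∣ a * b - a′ * b′ ∣                  ≡⟨ cong ∣_∣ (solve 4 (λ a a′ b b′ → a :* b :- a′ :* b′ := a :* (b :- b′) :+ (a :- a′) :* b′) refl a a′ b b′) ⟩
        ∣ a * (b - b′) + (a - a′) * b′ ∣      ≤⟨ ℚ.∣p+q∣≤∣p∣+∣q∣ (a * (b - b′)) ((a - a′) * b′) ⟩
        ∣ a * (b - b′) ∣ + ∣ (a - a′) * b′ ∣  ≡⟨ cong₂ _+_ (ℚ.∣p*q∣≡∣p∣*∣q∣ a (b - b′)) (ℚ.∣p*q∣≡∣p∣*∣q∣ (a - a′) b′) ⟩
        ∣ a ∣ * ∣ b - b′ ∣ + ∣ a - a′ ∣ * ∣ b′ ∣
          ≤⟨ ℚ.+-mono-≤ (*-mono-≤ (ℚ.0≤∣p∣ (b - b′)) (ℚ.<⇒≤ 0<B) aB db)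
                        (*-mono-≤ (ℚ.0≤∣p∣ b′) (ℚ.<⇒≤ 0<η) da bC) ⟩
        B * η + η * C                        ≡⟨ eq ⟩
        e                                    ∎
        where open ℚ.≤-Reasoning
      combine : ∀ {B C η} → 0ℚ < B → 0ℚ < η → B * η + η * C ≡ ε →
        Eventually (λ n → ∣ f n ∣ ≤ B) → Eventually (λ n → ∣ g′ n ∣ ≤ C) →
        ∃[ N ] (∀ m n → N ℕ.≤ m → N ℕ.≤ n → ∣ f m - f′ n ∣ ≤ η) →
        ∃[ N ] (∀ m n → N ℕ.≤ m → N ℕ.≤ n → ∣ g m - g′ n ∣ ≤ η) →
        ∃[ N ] ∀ m n → N ℕ.≤ m → N ℕ.≤ n → ∣ f m * g m - f′ n * g′ n ∣ ≤ ε
      combine 0<B 0<η eq (K , bB) (L , bC) (M , u) (N , v) = (K ℕ.⊔ L) ℕ.⊔ (M ℕ.⊔ N) , λ m n hm hn →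
        estimate 0<B 0<η eq
          (bB m (left (left {K ℕ.⊔ L} hm)))
          (bC n (right {K} (left {K ℕ.⊔ L} hn)))
          (u m n (left {M} (right {K ℕ.⊔ L} hm)) (left {M} (right {K ℕ.⊔ L} hn)))
          (v m n (right {M} (right {K ℕ.⊔ L} hm)) (right {M} (right {K ℕ.⊔ L} hn)))

    sqrt-∼ : ∀ {f g} → f ∼ g → (λ n → sqrt n (f n)) ∼ (λ n → sqrt n (g n))
    sqrt-∼ {f} {g} p ε 0<ε =
      combine (½ * ε) (½+½ ε) (p ((½ * ε) * (½ * ε)) (0<* (0<½ 0<ε) (0<½ 0<ε))) (δ-small (0<½ 0<ε))
      where
      estimate : ∀ {a b d e s t h} → 0ℚ ≤ d → 0ℚ ≤ e → Root d ∣ a ∣ s → Root e ∣ b ∣ t →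
        d ≤ h → e ≤ h → ∣ a - b ∣ ≤ h * h → ∣ s - t ∣ ≤ h + h
      estimate {a} {b} {d} {e} {s} {t} {h} 0≤d 0≤e S T d≤h e≤h ab = abs-≤
        (diff-nonneg (solve 3 (λ s t k → (t :+ k) :- s := k :- (s :- t)) refl s t (h + h))
          (nonneg-diff (sqrt-close 0≤e S T e≤h (ℚ.≤-trans (≤-abs _) (ℚ.≤-trans (abs-diff-abs a b) ab)))))
        (diff-nonneg (solve 3 (λ s t k → (s :+ k) :- t := k :- (:- (s :- t))) refl s t (h + h))
          (nonneg-diff (sqrt-close 0≤d T S d≤h (ℚ.≤-trans (≤-abs _) (ℚ.≤-trans (abs-diff-abs b a)
            (subst (_≤ h * h) (abs-sym a b) ab))))))
      combine : ∀ h → h + h ≡ ε →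
        ∃[ N ] (∀ m n → N ℕ.≤ m → N ℕ.≤ n → ∣ f m - g n ∣ ≤ h * h) →
        Eventually (λ n → δ n ≤ h) →
        ∃[ N ] ∀ m n → N ℕ.≤ m → N ℕ.≤ n → ∣ sqrt m (f m) - sqrt n (g n) ∣ ≤ ε
      combine h refl (M , u) (N , v) = M ℕ.⊔ N , λ m n hm hn →
        estimate (ℚ.<⇒≤ (0<δ m)) (ℚ.<⇒≤ (0<δ n)) (sqrt-root m (f m)) (sqrt-root n (g n))
          (v m (right {M} hm)) (v n (right {M} hn)) (u m n (left hm) (left hn))

    recip-∼ : ∀ {f g c} → 0ℚ < c → Eventually (λ n → c ≤ f n) → Eventually (λ n → c ≤ g n) →
      f ∼ g → (λ n → recip (f n)) ∼ (λ n → recip (g n))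
    recip-∼ {f} {g} {c} 0<c (K , bf) (L , bg) p ε 0<ε =
      let N , u = p (ε * (c * c)) (0<* 0<ε (0<* 0<c 0<c))
      in (K ℕ.⊔ L) ℕ.⊔ N , λ m n hm hn →
        recip-diff 0<c (bf m (left (left {K ℕ.⊔ L} hm))) (bg n (right {K} (left {K ℕ.⊔ L} hn)))
          (u m n (right {K ℕ.⊔ L} hm) (right {K ℕ.⊔ L} hn)) (ℚ.<⇒≤ 0<ε)

open Sequences

infix  4 _≈ᴿ_ _<ᴿ_
infixl 6 _+ᴿ_ _-ᴿ_
infixl 7 _*ᴿ_
infix  8 -ᴿ_ √_

_≈ᴿ_ : ℝ → ℝ → Set
x ≈ᴿ y = seq x ∼ seq y

_<ᴿ_ : ℝ → ℝ → Set
x <ᴿ y = ∃[ ε ] 0ℚ ℚ.< ε × Eventually (λ n → seq x n ℚ.+ ε ℚ.≤ seq y n)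

0ᴿ 1ᴿ : ℝ
0ᴿ = mkℝ (λ _ → 0ℚ) (const-∼ 0ℚ)
1ᴿ = mkℝ (λ _ → 1ℚ) (const-∼ 1ℚ)

_+ᴿ_ _*ᴿ_ : ℝ → ℝ → ℝ
x +ᴿ y = mkℝ (λ n → seq x n ℚ.+ seq y n) (+-∼ {seq x} {seq x} {seq y} {seq y} (cauchy x) (cauchy y))
x *ᴿ y = mkℝ (λ n → seq x n ℚ.* seq y n) (*-∼ {seq x} {seq x} {seq y} {seq y} (cauchy x) (cauchy y))

-ᴿ_ : ℝ → ℝ
-ᴿ x = mkℝ (λ n → ℚ.- seq x n) (neg-∼ {seq x} {seq x} (cauchy x))

_-ᴿ_ : ℝ → ℝ → ℝ
x -ᴿ y = x +ᴿ (-ᴿ y)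

-- The square root of the absolute value of x.
√_ : ℝ → ℝ
√ x = mkℝ (λ n → sqrt n (seq x n)) (sqrt-∼ {seq x} {seq x} (cauchy x))

record ℂ : Set where
  constructor _+i_
  field
    re : ℝ
    im : ℝ

open ℂ

record _≈ᶜ_ (z w : ℂ) : Set where
  constructor _,_
  field
    re-≈ : re z ≈ᴿ re w
    im-≈ : im z ≈ᴿ im w

infix 4 _≈ᶜ_

module ℂ-Ring where

  infixl 6 _+ᶜ_
  infixl 7 _*ᶜ_
  infix  8 -ᶜ_

  0ᶜ 1ᶜ : ℂ
  0ᶜ = 0ᴿ +i 0ᴿ
  1ᶜ = 1ᴿ +i 0ᴿ

  _+ᶜ_ _*ᶜ_ : ℂ → ℂ → ℂ
  z +ᶜ w = (re z +ᴿ re w) +i (im z +ᴿ im w)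
  z *ᶜ w = (re z *ᴿ re w -ᴿ im z *ᴿ im w) +i (re z *ᴿ im w +ᴿ im z *ᴿ re w)

  -ᶜ_ : ℂ → ℂ
  -ᶜ z = (-ᴿ re z) +i (-ᴿ im z)

  open +-*-Solver

  pointwise : ∀ {z w} → (∀ n → seq (re z) n ≡ seq (re w) n) → (∀ n → seq (im z) n ≡ seq (im w) n) → z ≈ᶜ w
  pointwise {z} {w} h k =
    ∼-pointwise {seq (re z)} {seq (re w)} (cauchy (re z)) h ,
    ∼-pointwise {seq (im z)} {seq (im w)} (cauchy (im z)) k

  ≈-sym : ∀ {z w} → z ≈ᶜ w → w ≈ᶜ z
  ≈-sym {z} {w} (h , k) = ∼-sym {seq (re z)} {seq (re w)} h , ∼-sym {seq (im z)} {seq (im w)} k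

  ≈-trans : ∀ {z w u} → z ≈ᶜ w → w ≈ᶜ u → z ≈ᶜ u
  ≈-trans {z} {w} {u} (h , k) (h′ , k′) =
    ∼-trans {seq (re z)} {seq (re w)} {seq (re u)} h h′ ,
    ∼-trans {seq (im z)} {seq (im w)} {seq (im u)} k k′

  +-cong : ∀ {z z′ w w′} → z ≈ᶜ z′ → w ≈ᶜ w′ → z +ᶜ w ≈ᶜ z′ +ᶜ w′
  +-cong {z} {z′} {w} {w′} (h , k) (h′ , k′) =
    +-∼ {seq (re z)} {seq (re z′)} {seq (re w)} {seq (re w′)} h h′ ,
    +-∼ {seq (im z)} {seq (im z′)} {seq (im w)} {seq (im w′)} k k′

  -‿cong : ∀ {z w} → z ≈ᶜ w → -ᶜ z ≈ᶜ -ᶜ w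
  -‿cong {z} {w} (h , k) = neg-∼ {seq (re z)} {seq (re w)} h , neg-∼ {seq (im z)} {seq (im w)} k

  *-congᴿ : ∀ x x′ y y′ → x ≈ᴿ x′ → y ≈ᴿ y′ → x *ᴿ y ≈ᴿ x′ *ᴿ y′
  *-congᴿ x x′ y y′ = *-∼ {seq x} {seq x′} {seq y} {seq y′}

  +-congᴿ : ∀ x x′ y y′ → x ≈ᴿ x′ → y ≈ᴿ y′ → x +ᴿ y ≈ᴿ x′ +ᴿ y′
  +-congᴿ x x′ y y′ = +-∼ {seq x} {seq x′} {seq y} {seq y′}

  *-cong : ∀ {z z′ w w′} → z ≈ᶜ z′ → w ≈ᶜ w′ → z *ᶜ w ≈ᶜ z′ *ᶜ w′
  *-cong {a +i b} {a′ +i b′} {c +i d} {c′ +i d′} (h , k) (h′ , k′) =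
    +-congᴿ (a *ᴿ c) (a′ *ᴿ c′) (-ᴿ (b *ᴿ d)) (-ᴿ (b′ *ᴿ d′))
      (*-congᴿ a a′ c c′ h h′)
      (neg-∼ {seq (b *ᴿ d)} {seq (b′ *ᴿ d′)} (*-congᴿ b b′ d d′ k k′)) ,
    +-congᴿ (a *ᴿ d) (a′ *ᴿ d′) (b *ᴿ c) (b′ *ᴿ c′)
      (*-congᴿ a a′ d d′ h k′)
      (*-congᴿ b b′ c c′ k h′)

  +-assoc : ∀ z w u → (z +ᶜ w) +ᶜ u ≈ᶜ z +ᶜ (w +ᶜ u)
  +-assoc (a +i b) (c +i d) (e +i f) = pointwise
    (λ n → ℚ.+-assoc (seq a n) (seq c n) (seq e n))
    (λ n → ℚ.+-assoc (seq b n) (seq d n) (seq f n))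

  +-comm : ∀ z w → z +ᶜ w ≈ᶜ w +ᶜ z
  +-comm (a +i b) (c +i d) = pointwise
    (λ n → ℚ.+-comm (seq a n) (seq c n))
    (λ n → ℚ.+-comm (seq b n) (seq d n))

  +-identityˡ : ∀ z → 0ᶜ +ᶜ z ≈ᶜ z
  +-identityˡ (a +i b) = pointwise
    (λ n → ℚ.+-identityˡ (seq a n))
    (λ n → ℚ.+-identityˡ (seq b n))

  -‿inverseˡ : ∀ z → (-ᶜ z) +ᶜ z ≈ᶜ 0ᶜ
  -‿inverseˡ (a +i b) = pointwise
    (λ n → ℚ.+-inverseˡ (seq a n))
    (λ n → ℚ.+-inverseˡ (seq b n))

  *-assoc : ∀ z w u → (z *ᶜ w) *ᶜ u ≈ᶜ z *ᶜ (w *ᶜ u)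
  *-assoc (a +i b) (c +i d) (e +i f) = pointwise
    (λ n → solve 6 (λ a b c d e f →
        (a :* c :- b :* d) :* e :- (a :* d :+ b :* c) :* f := a :* (c :* e :- d :* f) :- b :* (c :* f :+ d :* e))
      refl (seq a n) (seq b n) (seq c n) (seq d n) (seq e n) (seq f n))
    (λ n → solve 6 (λ a b c d e f →
        (a :* c :- b :* d) :* f :+ (a :* d :+ b :* c) :* e := a :* (c :* f :+ d :* e) :+ b :* (c :* e :- d :* f))
      refl (seq a n) (seq b n) (seq c n) (seq d n) (seq e n) (seq f n))

  *-comm : ∀ z w → z *ᶜ w ≈ᶜ w *ᶜ z
  *-comm (a +i b) (c +i d) = pointwise
    (λ n → solve 4 (λ a b c d → a :* c :- b :* d := c :* a :- d :* b) refl (seq a n) (seq b n) (seq c n) (seq d n))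
    (λ n → solve 4 (λ a b c d → a :* d :+ b :* c := c :* b :+ d :* a) refl (seq a n) (seq b n) (seq c n) (seq d n))

  *-identityˡ : ∀ z → 1ᶜ *ᶜ z ≈ᶜ z
  *-identityˡ (a +i b) = pointwise
    (λ n → solve 2 (λ a b → con 1ℚ :* a :- con 0ℚ :* b := a) refl (seq a n) (seq b n))
    (λ n → solve 2 (λ a b → con 1ℚ :* b :+ con 0ℚ :* a := b) refl (seq a n) (seq b n))

  *-distribˡ-+ : ∀ z w u → z *ᶜ (w +ᶜ u) ≈ᶜ (z *ᶜ w) +ᶜ (z *ᶜ u)
  *-distribˡ-+ (a +i b) (c +i d) (e +i f) = pointwise
    (λ n → solve 6 (λ a b c d e f →
        a :* (c :+ e) :- b :* (d :+ f) := (a :* c :- b :* d) :+ (a :* e :- b :* f))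
      refl (seq a n) (seq b n) (seq c n) (seq d n) (seq e n) (seq f n))
    (λ n → solve 6 (λ a b c d e f →
        a :* (d :+ f) :+ b :* (c :+ e) := (a :* d :+ b :* c) :+ (a :* f :+ b :* e))
      refl (seq a n) (seq b n) (seq c n) (seq d n) (seq e n) (seq f n))

  ≈-refl : ∀ {z} → z ≈ᶜ z
  ≈-refl {z} = cauchy (re z) , cauchy (im z)

  +-identityʳ : ∀ z → z +ᶜ 0ᶜ ≈ᶜ z
  +-identityʳ z = ≈-trans {z +ᶜ 0ᶜ} {0ᶜ +ᶜ z} {z} (+-comm z 0ᶜ) (+-identityˡ z)

  -‿inverseʳ : ∀ z → z +ᶜ (-ᶜ z) ≈ᶜ 0ᶜ
  -‿inverseʳ z = ≈-trans {z +ᶜ (-ᶜ z)} { (-ᶜ z) +ᶜ z } {0ᶜ} (+-comm z (-ᶜ z)) (-‿inverseˡ z)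

  *-identityʳ : ∀ z → z *ᶜ 1ᶜ ≈ᶜ z
  *-identityʳ z = ≈-trans {z *ᶜ 1ᶜ} {1ᶜ *ᶜ z} {z} (*-comm z 1ᶜ) (*-identityˡ z)

  *-distribʳ-+ : ∀ z w u → (w +ᶜ u) *ᶜ z ≈ᶜ (w *ᶜ z) +ᶜ (u *ᶜ z)
  *-distribʳ-+ z w u = ≈-trans { (w +ᶜ u) *ᶜ z } {z *ᶜ (w +ᶜ u)} { (w *ᶜ z) +ᶜ (u *ᶜ z) } (*-comm (w +ᶜ u) z)
    (≈-trans {z *ᶜ (w +ᶜ u)} { (z *ᶜ w) +ᶜ (z *ᶜ u) } { (w *ᶜ z) +ᶜ (u *ᶜ z) } (*-distribˡ-+ z w u)
      (+-cong {z *ᶜ w} {w *ᶜ z} {z *ᶜ u} {u *ᶜ z} (*-comm z w) (*-comm z u)))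

  isEquivalence : IsEquivalence _≈ᶜ_
  isEquivalence = record
    { refl  = λ {z} → ≈-refl {z}
    ; sym   = λ {z} {w} → ≈-sym {z} {w}
    ; trans = λ {z} {w} {u} → ≈-trans {z} {w} {u} }

  +-isMonoid : IsMonoid _≈ᶜ_ _+ᶜ_ 0ᶜ
  +-isMonoid = record
    { isSemigroup = record
      { isMagma = record
        { isEquivalence = isEquivalence
        ; ∙-cong = λ {z} {z′} {w} {w′} → +-cong {z} {z′} {w} {w′} }
      ; assoc = +-assoc }
    ; identity = +-identityˡ , +-identityʳ }

  +-isAbelianGroup : IsAbelianGroup _≈ᶜ_ _+ᶜ_ 0ᶜ -ᶜ_
  +-isAbelianGroup = record
    { isGroup = record
      { isMonoid = +-isMonoid
      ; inverse = -‿inverseˡ , -‿inverseʳ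
      ; ⁻¹-cong = -‿cong }
    ; comm = +-comm }

  isCommutativeRing : IsCommutativeRing _≈ᶜ_ _+ᶜ_ _*ᶜ_ -ᶜ_ 0ᶜ 1ᶜ
  isCommutativeRing = record
    { isRing = record
      { +-isAbelianGroup = +-isAbelianGroup
      ; *-cong = λ {z} {z′} {w} {w′} → *-cong {z} {z′} {w} {w′}
      ; *-assoc = *-assoc
      ; *-identity = *-identityˡ , *-identityʳ
      ; distrib = *-distribˡ-+ , *-distribʳ-+ }
    ; *-comm = *-comm }

  commutativeRing : CommutativeRing 0ℓ 0ℓ
  commutativeRing = record { isCommutativeRing = isCommutativeRing }

open CommutativeRing ℂ-Ring.commutativeRing public
  using (_≈_; _+_; _*_; -_; _-_)
  renaming (0# to 0ℂ; 1# to 1ℂ)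

open import Algebra.Definitions.RawSemiring (Semiring.rawSemiring (CommutativeRing.semiring ℂ-Ring.commutativeRing)) public
  using (_^_; product)
  renaming (_×_ to _·_)

open import Algebra.Properties.CommutativeMonoid.Sum (CommutativeRing.+-commutativeMonoid ℂ-Ring.commutativeRing) public
  using (sum-syntax)

∣_∣² : ℂ → ℝ
∣ z ∣² = re z *ᴿ re z +ᴿ im z *ᴿ im z

∣_∣ : ℂ → ℝ
∣ z ∣ = √ ∣ z ∣²

-- Constructively, inverting z − w takes a positive lower bound on ∣z − w∣;
-- classically this is z ≠ w.
infix 4 _#_
_#_ : ℂ → ℂ → Set
z # w = 0ᴿ <ᴿ ∣ z - w ∣

module Apartness where

  open Rationals hiding (sqrt; recip)
  open +-*-Solver

  norm : ℂ → ℕ → ℚ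
  norm z = seq ∣ z ∣²

  Away : ℂ → Set
  Away z = ∃[ c ] 0ℚ ℚ.< c × Eventually (λ n → c ℚ.≤ norm z n)

  abstract
    0≤norm : ∀ z n → 0ℚ ℚ.≤ norm z n
    0≤norm z n = 0≤+ (0≤sq (seq (re z) n)) (0≤sq (seq (im z) n))

    norm-abs : ∀ z n → ℚ.∣ norm z n ∣ ≡ norm z n
    norm-abs z n = ℚ.0≤p⇒∣p∣≡p (0≤norm z n)

    norm-* : ∀ z w n → norm (z * w) n ≡ norm z n ℚ.* norm w n
    norm-* (a +i b) (c +i d) n = solve 4
      (λ a b c d → (a :* c :- b :* d) :* (a :* c :- b :* d) :+ (a :* d :+ b :* c) :* (a :* d :+ b :* c)
                   := (a :* a :+ b :* b) :* (c :* c :+ d :* d))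
      refl (seq a n) (seq b n) (seq c n) (seq d n)

    norm-sub-0 : ∀ z n → norm (z - 0ℂ) n ≡ norm z n
    norm-sub-0 (a +i b) n = solve 2
      (λ a b → (a :- con 0ℚ) :* (a :- con 0ℚ) :+ (b :- con 0ℚ) :* (b :- con 0ℚ) := a :* a :+ b :* b)
      refl (seq a n) (seq b n)

    norm-sub-comm : ∀ z w n → norm (z - w) n ≡ norm (w - z) n
    norm-sub-comm (a +i b) (c +i d) n = solve 4
      (λ a b c d → (a :- c) :* (a :- c) :+ (b :- d) :* (b :- d) := (c :- a) :* (c :- a) :+ (d :- b) :* (d :- b))
      refl (seq a n) (seq b n) (seq c n) (seq d n)

    Away-cong : ∀ z w → (∀ n → norm z n ≡ norm w n) → Away z → Away w
    Away-cong z w eq (c , 0<c , N , h) = c , 0<c , N , λ n hn → subst (c ℚ.≤_) (eq n) (h n hn)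

    Away-* : ∀ z w → Away z → Away w → Away (z * w)
    Away-* z w (c , 0<c , hz) (d , 0<d , hw) = c ℚ.* d , 0<* 0<c 0<d ,
      both (λ {n} p q → subst (c ℚ.* d ℚ.≤_) (sym (norm-* z w n))
             (*-mono-≤ (ℚ.<⇒≤ 0<d) (0≤norm z n) p q)) hz hw

    #⇒Away : ∀ z w → z # w → Away (z - w)
    #⇒Away z w (ε , 0<ε , N , h) = ε ℚ.* ε , 0<* 0<ε 0<ε , N , λ n hn →
      subst (ε ℚ.* ε ℚ.≤_) (norm-abs (z - w) n)
        (sqrt-lower (sqrt-root n (norm (z - w) n)) (ℚ.<⇒≤ 0<ε)
          (subst (ℚ._≤ seq ∣ z - w ∣ n) (ℚ.+-identityˡ ε) (h n hn)))

    Away⇒# : ∀ z w → Away (z - w) → z # w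
    Away⇒# z w (c , 0<c , h) =
      let d , 0<d , d≤1 , d≤c = cap in
      ½ ℚ.* d , 0<½ 0<d ,
      both (λ {n} δ≤e c≤ → subst (ℚ._≤ seq ∣ z - w ∣ n) (sym (ℚ.+-identityˡ (½ ℚ.* d)))
             (sqrt-above (sqrt-root n (norm (z - w) n)) (ℚ.<⇒≤ (0<δ n)) (ℚ.<⇒≤ (0<½ 0<d)) δ≤e
               (subst (ℚ._≤ 1ℚ) (sym (½+½ d)) d≤1) (subst (ℚ._≤ c) (sym (½+½ d)) d≤c)
               (subst (c ℚ.≤_) (sym (norm-abs (z - w) n)) c≤)))
        (δ-small (0<½ 0<d)) h
      where
      cap : ∃[ d ] 0ℚ ℚ.< d × d ℚ.≤ 1ℚ × d ℚ.≤ c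
      cap with ℚ.≤-total c 1ℚ
      ... | inj₁ c≤1 = c , 0<c , c≤1 , ℚ.≤-refl
      ... | inj₂ 1≤c = 1ℚ , ℚ.positive⁻¹ 1ℚ , ℚ.≤-refl , 1≤c

    #0⇒Away : ∀ z → z # 0ℂ → Away z
    #0⇒Away z h = Away-cong (z - 0ℂ) z (norm-sub-0 z) (#⇒Away z 0ℂ h)

    Away⇒#0 : ∀ z → Away z → z # 0ℂ
    Away⇒#0 z h = Away⇒# z 0ℂ (Away-cong z (z - 0ℂ) (λ n → sym (norm-sub-0 z n)) h)

    norm-below-1 : ∀ z → ∣ z ∣ <ᴿ 1ᴿ → ∃[ c ] 0ℚ ℚ.< c × Eventually (λ n → norm z n ℚ.+ c ℚ.≤ 1ℚ)
    norm-below-1 z (ε , 0<ε , h) = ½ ℚ.* ε , 0<½ 0<ε ,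
      both (λ {n} δ≤ s≤ → subst (λ t → t ℚ.+ ½ ℚ.* ε ℚ.≤ 1ℚ) (norm-abs z n)
             (sqrt-below-1 (ℚ.<⇒≤ (0<δ n)) (sqrt-root n (norm z n)) (ℚ.<⇒≤ (0<½ 0<ε)) δ≤
               (subst (λ t → seq ∣ z ∣ n ℚ.+ t ℚ.≤ 1ℚ) (sym (½+½ ε)) s≤)))
        (δ-small (0<½ 0<ε)) h

    norm-^-≤ : ∀ z k n → norm z n ℚ.≤ 1ℚ → norm (z ^ k) n ℚ.≤ 1ℚ
    norm-^-≤ z zero    n h = ℚ.≤-refl
    norm-^-≤ z (suc k) n h = subst (ℚ._≤ 1ℚ) (sym (norm-* z (z ^ k) n))
      (*-mono-≤ (0≤norm (z ^ k) n) (ℚ.nonNegative⁻¹ 1ℚ) h (norm-^-≤ z k n h))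

    norm-^-below-1 : ∀ z k n c → 0ℚ ℚ.≤ c → norm z n ℚ.+ c ℚ.≤ 1ℚ → norm (z ^ suc k) n ℚ.+ c ℚ.≤ 1ℚ
    norm-^-below-1 z k n c 0≤c h = ℚ.≤-trans (ℚ.+-monoˡ-≤ c
      (ℚ.≤-trans (ℚ.≤-reflexive (norm-* z (z ^ k) n))
        (ℚ.≤-trans (*-mono-≤ (0≤norm (z ^ k) n) (0≤norm z n) ℚ.≤-refl (norm-^-≤ z k n z≤1))
          (ℚ.≤-reflexive (ℚ.*-identityʳ (norm z n)))))) h
      where
      z≤1 : norm z n ℚ.≤ 1ℚ
      z≤1 = ℚ.≤-trans (diff-nonneg (solve 2 (λ u c → c := (u :+ c) :- u) refl (norm z n) c) 0≤c) h

    Away-1- : ∀ z c → 0ℚ ℚ.< c → Eventually (λ n → norm z n ℚ.+ c ℚ.≤ 1ℚ) → Away (1ℂ - z)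
    Away-1- (a +i b) c 0<c (N , h) = ½ ℚ.* c ℚ.* (½ ℚ.* c) , 0<* (0<½ 0<c) (0<½ 0<c) , N , λ n hn →
      bound (seq a n) (seq b n) (h n hn)
      where
      bound : ∀ x y → x ℚ.* x ℚ.+ y ℚ.* y ℚ.+ c ℚ.≤ 1ℚ →
        ½ ℚ.* c ℚ.* (½ ℚ.* c) ℚ.≤ (1ℚ ℚ.- x) ℚ.* (1ℚ ℚ.- x) ℚ.+ (0ℚ ℚ.- y) ℚ.* (0ℚ ℚ.- y)
      bound x y hyp = ℚ.≤-trans (*-mono-≤ 0≤½c (ℚ.≤-trans 0≤½c ½c≤) ½c≤ ½c≤)
        (diff-nonneg (solve 2 (λ x y → (con 0ℚ :- y) :* (con 0ℚ :- y) :=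
            ((con 1ℚ :- x) :* (con 1ℚ :- x) :+ (con 0ℚ :- y) :* (con 0ℚ :- y)) :- (con 1ℚ :- x) :* (con 1ℚ :- x)) refl x y)
          (0≤sq (0ℚ ℚ.- y)))
        where
        0≤½c : 0ℚ ℚ.≤ ½ ℚ.* c
        0≤½c = ℚ.<⇒≤ (0<½ 0<c)
        ½c≤ : ½ ℚ.* c ℚ.≤ 1ℚ ℚ.- x
        ½c≤ = diff-nonneg
          (solve 3 (λ x y c → con ½ :* (((con 1ℚ :- x) :* (con 1ℚ :- x) :+ (con 1ℚ :- (x :* x :+ y :* y :+ c))) :+ y :* y)
                              := (con 1ℚ :- x) :- con ½ :* c) refl x y c)
          (0≤* (ℚ.nonNegative⁻¹ ½) (0≤+ (0≤+ (0≤sq (1ℚ ℚ.- x)) (nonneg-diff hyp)) (0≤sq y)))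

    Away-product : ∀ n (v : Fin n → ℂ) → (∀ j → Away (v j)) → Away (product v)
    Away-product zero    v h = 1ℚ , ℚ.positive⁻¹ 1ℚ , 0 , λ _ _ → ℚ.≤-refl
    Away-product (suc n) v h = Away-* (v zero) (product (λ j → v (suc j))) (h zero)
      (Away-product n (λ j → v (suc j)) (λ j → h (suc j)))

open Apartness using (norm; #0⇒Away)

infix 9 _⁻¹[_]
_⁻¹[_] : (z : ℂ) → z # 0ℂ → ℂ
z ⁻¹[ z#0 ] = (re z *ᴿ r) +i ((-ᴿ im z) *ᴿ r)
  where
  r : ℝ
  r = mkℝ (λ n → recip (norm z n))
    (let _ , 0<c , h = #0⇒Away z z#0 in recip-∼ {norm z} {norm z} 0<c h h (cauchy ∣ z ∣²))

infixl 7 _/_[_]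
_/_[_] : (z w : ℂ) → w # 0ℂ → ℂ
z / w [ w#0 ] = z * w ⁻¹[ w#0 ]

abstract
  ⁻¹-inverseʳ : ∀ z (z#0 : z # 0ℂ) → z * z ⁻¹[ z#0 ] ≈ 1ℂ
  ⁻¹-inverseʳ z@(a +i b) z#0 =
    ∼-eventually {seq (re (z * z ⁻¹[ z#0 ]))} {seq 1ᴿ} (cauchy (re (z * z ⁻¹[ z#0 ])))
      (let c , 0<c , N , h = #0⇒Away z z#0 in N , λ n hn → trans
        (solve 3 (λ a b r → a :* (a :* r) :- b :* ((:- b) :* r) := (a :* a :+ b :* b) :* r)
          refl (seq a n) (seq b n) (recip (norm z n)))
        (Rationals.recip-inverse (ℚ.<-≤-trans 0<c (h n hn)))) ,
    ∼-pointwise {seq (im (z * z ⁻¹[ z#0 ]))} {seq 0ᴿ} (cauchy (im (z * z ⁻¹[ z#0 ])))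
      (λ n → solve 3 (λ a b r → a :* ((:- b) :* r) :+ b :* (a :* r) := con 0ℚ)
        refl (seq a n) (seq b n) (recip (norm z n)))
    where open +-*-Solver

  #1⇒1-#0 : ∀ z → z # 1ℂ → 1ℂ - z # 0ℂ
  #1⇒1-#0 z h = Apartness.Away⇒#0 (1ℂ - z)
    (Apartness.Away-cong (z - 1ℂ) (1ℂ - z) (Apartness.norm-sub-comm z 1ℂ) (Apartness.#⇒Away z 1ℂ h))

⟨_⨾_⟩_ : ℂ → ℂ → ℕ → ℂ
⟨ a ⨾ q ⟩ n = product {n} (λ j → 1ℂ - a * q ^ toℕ j)

abstract
  ⟨q⨾q⟩*⟨q⨾q⟩#0 : ∀ q → ∣ q ∣ <ᴿ 1ᴿ → ∀ m n → ⟨ q ⨾ q ⟩ m * ⟨ q ⨾ q ⟩ n # 0ℂ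
  ⟨q⨾q⟩*⟨q⨾q⟩#0 q q<1 m n = Away⇒#0 (⟨ q ⨾ q ⟩ m * ⟨ q ⨾ q ⟩ n)
    (Away-* (⟨ q ⨾ q ⟩ m) (⟨ q ⨾ q ⟩ n) (away m) (away n))
    where
    open Apartness
    factor : ∀ k → Away (1ℂ - q ^ suc k)
    factor k = let c , 0<c , N , h = norm-below-1 q q<1 in
      Away-1- (q ^ suc k) c 0<c (N , λ n hn → norm-^-below-1 q k n c (ℚ.<⇒≤ 0<c) (h n hn))
    away : ∀ k → Away (⟨ q ⨾ q ⟩ k)
    away k = Away-product k (λ j → 1ℂ - q * q ^ toℕ j) (λ j → factor (toℕ j))

qBinomial : (q : ℂ) → ∣ q ∣ <ᴿ 1ᴿ → (n : ℕ) → Fin (suc n) → ℂ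
qBinomial q q<1 n k =
  ⟨ q ⨾ q ⟩ n / (⟨ q ⨾ q ⟩ (toℕ k) * ⟨ q ⨾ q ⟩ (n ∸ toℕ k)) [ ⟨q⨾q⟩*⟨q⨾q⟩#0 q q<1 (toℕ k) (n ∸ toℕ k) ]

{-# OPTIONS --safe #-}
module Submission where

open import Algebra.Bundles using (CommutativeRing; Semiring)
import Data.Nat.Properties as ℕ
open import Data.Fin.Base using (Fin; suc; toℕ; inject₁; fromℕ)
open import Data.Fin.Properties using (toℕ-inject₁; toℕ-fromℕ; toℕ<n)
open import Data.Nat.Base as ℕ using (ℕ; zero; suc; _∸_; _≥_; _<_; s≤s)
open import Data.Nat.Combinatorics using (_C_; nC1≡n; nCk+nC[k+1]≡[n+1]C[k+1])
open import Function.Base using (_∘_)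
open import Relation.Binary.PropositionalEquality.Core as ≡ using (_≡_)

-- With s = -ax and e n k the k-th elementary symmetric polynomial of
-- 1, q, …, qⁿ⁻¹, the product (ax; q)ₙ = ∏ (1 + s qʲ) expands as Σ e n k sᵏ
-- (the q-binomial theorem), and e n k is the q-binomial coefficient times
-- q^(k choose 2). Both sides of the theorem are then the derivative of this
-- product with respect to s: termwise on the left, by the Leibniz rule on the
-- right. Concretely, both satisfy Dₙ₊₁ = (1 + s qⁿ) Dₙ + qⁿ (ax; q)ₙ.
module ElementarySymmetric {c ℓ} (R : CommutativeRing c ℓ) (q : CommutativeRing.Carrier R) where

  open CommutativeRing R hiding (zero)
  open import Algebra.Definitions.RawSemiring (Semiring.rawSemiring semiring) using (_^_; _×_; product)
  open import Algebra.Properties.Ring ring using (-‿distribˡ-*)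
  open import Algebra.Properties.Monoid.Mult +-monoid using (×-congʳ)
  open import Algebra.Properties.CommutativeMonoid.Mult +-commutativeMonoid using (×-distrib-+)
  open import Algebra.Properties.Semiring.Mult semiring using (×-comm-*)
  open import Algebra.Properties.Semiring.Exp semiring using (^-homo-*; ^-congʳ)
  open import Algebra.Properties.Semiring.Sum semiring
    using (sum; sum-cong-≋; sum-init-last; ∑-distrib-+; *-distribˡ-sum)
  import Algebra.Properties.CommutativeMonoid.Sum *-commutativeMonoid as Product
  open import Algebra.Solver.Ring.NaturalCoefficients.Default commutativeSemiring using (solve; _:=_; _:+_; _:*_; con)
  open import Relation.Binary.Reasoning.Setoid setoid

  -- Finite sums and q-Pochhammer products.

  -- Summands are indexed by ℕ rather than `Fin n`, so that one sequence can be summed to different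
  -- lengths and shifted by `suc`.
  ∑ : ℕ → (ℕ → Carrier) → Carrier
  ∑ n f = sum {n} (f ∘ toℕ)

  ∑-suc : ∀ n f → ∑ (suc n) f ≈ ∑ n f + f n
  ∑-suc n f = trans (sum-init-last {n} (f ∘ toℕ)) (+-cong
    (sum-cong-≋ {n} (λ i → reflexive (≡.cong f (toℕ-inject₁ i))))
    (reflexive (≡.cong f (toℕ-fromℕ n))))

  ∑-cong : ∀ n {f g} → (∀ i → f i ≈ g i) → ∑ n f ≈ ∑ n g
  ∑-cong n h = sum-cong-≋ {n} (h ∘ toℕ)

  ∑-+* : ∀ n f z g → ∑ n (λ i → f i + z * g i) ≈ ∑ n f + z * ∑ n g
  ∑-+* n f z g = trans (∑-distrib-+ {n} (f ∘ toℕ) (λ i → z * g (toℕ i)))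
    (+-congˡ (sym (*-distribˡ-sum {n} z (g ∘ toℕ))))

  pochhammer : Carrier → ℕ → Carrier
  pochhammer t n = product {n} (λ j → 1# - t * q ^ toℕ j)

  pochhammer-suc : ∀ t n → pochhammer t (suc n) ≈ pochhammer t n * (1# - t * q ^ n)
  pochhammer-suc t n = trans (Product.sum-init-last {n} (factor ∘ toℕ)) (*-cong
    (Product.sum-cong-≋ {n} (λ i → reflexive (≡.cong factor (toℕ-inject₁ i))))
    (reflexive (≡.cong factor (toℕ-fromℕ n))))
    where
    factor : ℕ → Carrier
    factor j = 1# - t * q ^ j

  -- Elementary symmetric polynomials of the powers of q.

  -- The last clause sorts the choices of `suc k` elements among 1, q, ..., qⁿ by whether qⁿ is
  -- chosen.
  e : ℕ → ℕ → Carrier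
  e n       zero    = 1#
  e zero    (suc k) = 0#
  e (suc n) (suc k) = e n (suc k) + q ^ n * e n k

  e-vanish : ∀ {n k} → n < k → e n k ≈ 0#
  e-vanish {zero}  {suc k} _         = refl
  e-vanish {suc n} {suc k} (s≤s n<k) = begin
    e n (suc k) + q ^ n * e n k ≈⟨ +-cong (e-vanish (ℕ.m<n⇒m<1+n n<k)) (*-congˡ (e-vanish n<k)) ⟩
    0# + q ^ n * 0#             ≈⟨ +-identityˡ _ ⟩
    q ^ n * 0#                  ≈⟨ zeroʳ _ ⟩
    0#                          ∎

  -- The generating polynomial and its derivative.

  module GeneratingFunction (t : Carrier) where

    s : Carrier
    s = - t

    -- The index of `deriv` is shifted: its summand at i is the derivative of the term of `poly` of
    -- degree i + 1.
    poly deriv : ℕ → Carrier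
    poly n  = ∑ (suc n) (λ i → e n i * s ^ i)
    deriv n = ∑ n (λ i → suc i × (e n (suc i) * s ^ i))

    ∑-vanish : ∀ n f → f n ≈ 0# → ∑ (suc n) f ≈ ∑ n f
    ∑-vanish n f h = trans (∑-suc n f) (trans (+-congˡ h) (+-identityʳ _))

    ×-zero : ∀ n {x} → x ≈ 0# → n × x ≈ 0#
    ×-zero zero    h = refl
    ×-zero (suc n) h = trans (+-cong h (×-zero n h)) (+-identityˡ 0#)

    poly-suc : ∀ n → poly (suc n) ≈ (1# + s * q ^ n) * poly n
    poly-suc n = begin
      1# * 1# + ∑ (suc n) (λ i → (e n (suc i) + q ^ n * e n i) * (s * s ^ i))
        ≈⟨ +-congˡ (∑-cong (suc n) λ i → solve 5
             (λ a p b s z → (a :+ p :* b) :* (s :* z) := a :* (s :* z) :+ (s :* p) :* (b :* z))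
             refl (e n (suc i)) (q ^ n) (e n i) s (s ^ i)) ⟩
      1# * 1# + ∑ (suc n) (λ i → term (suc i) + (s * q ^ n) * term i)
        ≈⟨ +-congˡ (∑-+* (suc n) (term ∘ suc) (s * q ^ n) term) ⟩
      1# * 1# + (∑ (suc n) (term ∘ suc) + (s * q ^ n) * poly n)
        -- The leading `1# * 1#` is `term 0`, so it completes the shifted sum. The top term that
        -- this leaves over contains `e n (suc n)` and vanishes.
        ≈⟨ +-assoc _ _ _ ⟨
      ∑ (suc (suc n)) term + (s * q ^ n) * poly n
        ≈⟨ +-congʳ (∑-vanish (suc n) term (trans (*-congʳ (e-vanish {n} ℕ.≤-refl)) (zeroˡ _))) ⟩
      poly n + (s * q ^ n) * poly n
        ≈⟨ solve 2 (λ P z → P :+ z :* P := (con 1 :+ z) :* P) refl (poly n) (s * q ^ n) ⟩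
      (1# + s * q ^ n) * poly n ∎
      where
      term : ℕ → Carrier
      term i = e n i * s ^ i

    -- The Leibniz rule for the product in `poly-suc`, checked on coefficients, since
    -- differentiation is available only termwise.
    deriv-suc : ∀ n → deriv (suc n) ≈ (1# + s * q ^ n) * deriv n + q ^ n * poly n
    deriv-suc n = begin
      ∑ (suc n) (λ i → suc i × ((e n (suc i) + q ^ n * e n i) * s ^ i))
        ≈⟨ ∑-cong (suc n) split ⟩
      ∑ (suc n) (λ i → dterm i + q ^ n * (suc i × term i))
        ≈⟨ ∑-+* (suc n) dterm (q ^ n) (λ i → suc i × term i) ⟩
      -- The multiple `suc i × term i` unfolds to `term i + i × term i`. The first part sums to
      -- `poly n`; the second starts with `0 × term 0`, which is the `0#` below.
      ∑ (suc n) dterm + q ^ n * ∑ (suc n) (λ i → term i + i × term i)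
        ≈⟨ +-cong
             (∑-vanish n dterm (×-zero (suc n) (trans (*-congʳ (e-vanish {n} ℕ.≤-refl)) (zeroˡ _))))
             (*-congˡ (∑-distrib-+ {suc n} (term ∘ toℕ) (λ i → toℕ i × term (toℕ i)))) ⟩
      deriv n + q ^ n * (poly n + (0# + ∑ n (λ i → suc i × term (suc i))))
        ≈⟨ +-congˡ (*-congˡ (+-congˡ (+-congˡ shift))) ⟩
      deriv n + q ^ n * (poly n + (0# + s * deriv n))
        ≈⟨ solve 4 (λ D p P s → D :+ p :* (P :+ (con 0 :+ s :* D)) := (con 1 :+ s :* p) :* D :+ p :* P)
             refl (deriv n) (q ^ n) (poly n) s ⟩
      (1# + s * q ^ n) * deriv n + q ^ n * poly n ∎
      where
      term dterm : ℕ → Carrier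
      term i  = e n i * s ^ i
      dterm i = suc i × (e n (suc i) * s ^ i)
      split : ∀ i → suc i × ((e n (suc i) + q ^ n * e n i) * s ^ i) ≈ dterm i + q ^ n * (suc i × term i)
      split i = begin
        suc i × ((e n (suc i) + q ^ n * e n i) * s ^ i)
          ≈⟨ ×-congʳ (suc i) (solve 4 (λ a p b z → (a :+ p :* b) :* z := a :* z :+ p :* (b :* z))
               refl (e n (suc i)) (q ^ n) (e n i) (s ^ i)) ⟩
        suc i × (e n (suc i) * s ^ i + q ^ n * term i)
          ≈⟨ ×-distrib-+ _ _ (suc i) ⟩
        dterm i + suc i × (q ^ n * term i)
          ≈⟨ +-congˡ (×-comm-* (suc i) (q ^ n) (term i)) ⟨
        dterm i + q ^ n * (suc i × term i) ∎
      -- Weighting each term by its degree applies the operator s d/ds to `poly n`.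
      shift : ∑ n (λ i → suc i × term (suc i)) ≈ s * deriv n
      shift = trans
        (∑-cong n λ i → trans
          (×-congʳ (suc i) (solve 3 (λ a s z → a :* (s :* z) := s :* (a :* z)) refl (e n (suc i)) s (s ^ i)))
          (sym (×-comm-* (suc i) s _)))
        (sym (*-distribˡ-sum {n} s (dterm ∘ toℕ)))

    factor≈ : ∀ n → 1# - t * q ^ n ≈ 1# + s * q ^ n
    factor≈ n = +-congˡ (-‿distribˡ-* t (q ^ n))

    pochhammer≈poly : ∀ n → pochhammer t n ≈ poly n
    pochhammer≈poly zero    = solve 0 (con 1 := con 1 :* con 1 :+ con 0) refl
    pochhammer≈poly (suc n) = begin
      pochhammer t (suc n)              ≈⟨ pochhammer-suc t n ⟩
      pochhammer t n * (1# - t * q ^ n) ≈⟨ *-cong (pochhammer≈poly n) (factor≈ n) ⟩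
      poly n * (1# + s * q ^ n)         ≈⟨ *-comm _ _ ⟩
      (1# + s * q ^ n) * poly n         ≈⟨ poly-suc n ⟨
      poly (suc n)                      ∎

    -- A commutative ring has no division, so the inverses of the factors enter as a family `u`. The
    -- left side is then the product times its logarithmic derivative, up to sign.
    pochhammer*∑≈deriv : ∀ n (u : Fin n → Carrier) →
      (∀ k → (1# - t * q ^ toℕ k) * u k ≈ 1#) →
      pochhammer t n * sum (λ k → q ^ toℕ k * u k) ≈ deriv n
    pochhammer*∑≈deriv zero    u inv = zeroʳ _
    pochhammer*∑≈deriv (suc n) u inv = begin
      pochhammer t (suc n) * sum (λ k → q ^ toℕ k * u k)
        ≈⟨ *-cong (pochhammer-suc t n) (trans (sum-init-last (λ k → q ^ toℕ k * u k)) (+-cong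
             (sum-cong-≋ {n} (λ k → *-congʳ (^-congʳ q (toℕ-inject₁ k))))
             (*-congʳ (^-congʳ q (toℕ-fromℕ n))))) ⟩
      (pochhammer t n * F) * (Σ′ + q ^ n * w)
        -- The new factor `F` multiplies the earlier sum and meets its own inverse `w` in the last
        -- summand, which gives the recurrence of `deriv-suc`.
        ≈⟨ solve 5 (λ P F S p w → (P :* F) :* (S :+ p :* w) := F :* (P :* S) :+ p :* P :* (F :* w))
             refl (pochhammer t n) F Σ′ (q ^ n) w ⟩
      F * (pochhammer t n * Σ′) + q ^ n * pochhammer t n * (F * w)
        ≈⟨ +-cong
             (*-cong (factor≈ n) (pochhammer*∑≈deriv n (u ∘ inject₁) λ k →
               trans (*-congʳ (+-congˡ (-‿cong (*-congˡ (^-congʳ q (≡.sym (toℕ-inject₁ k)))))))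
                     (inv (inject₁ k))))
             (*-cong (*-congˡ (pochhammer≈poly n))
               (trans (*-congʳ (+-congˡ (-‿cong (*-congˡ (^-congʳ q (≡.sym (toℕ-fromℕ n)))))))
                      (inv (fromℕ n)))) ⟩
      (1# + s * q ^ n) * deriv n + q ^ n * poly n * 1#
        ≈⟨ +-congˡ (*-identityʳ _) ⟩
      (1# + s * q ^ n) * deriv n + q ^ n * poly n
        ≈⟨ deriv-suc n ⟨
      deriv (suc n) ∎
      where
      F Σ′ w : Carrier
      F  = 1# - t * q ^ n
      Σ′ = sum {n} (λ k → q ^ toℕ k * u (inject₁ k))
      w  = u (fromℕ n)

  open GeneratingFunction public using (pochhammer*∑≈deriv)

  -- Link with the q-binomial coefficients.

  -- At x = q^(k+1) and y = q^(m+1) this is the numerator identity behind the q-Pascal rule.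
  1-y+y[1-x] : ∀ x y → (1# - y) + y * (1# - x) ≈ 1# - x * y
  1-y+y[1-x] x y = begin
    (1# - y) + y * (1# - x)
      -- The solver works over semirings, so `- y` and `- x` are passed as independent atoms and y
      -- cancels only afterwards.
      ≈⟨ solve 3 (λ y y⁻ x⁻ → (con 1 :+ y⁻) :+ y :* (con 1 :+ x⁻) := (con 1 :+ x⁻ :* y) :+ (y :+ y⁻))
           refl y (- y) (- x) ⟩
    (1# + - x * y) + (y - y) ≈⟨ +-cong (+-congˡ (sym (-‿distribˡ-* x y))) (-‿inverseʳ y) ⟩
    (1# - x * y) + 0#        ≈⟨ +-identityʳ _ ⟩
    1# - x * y               ∎

  q^[1+k]C2 : ∀ k → q ^ (suc k C 2) ≈ q ^ k * q ^ (k C 2)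
  q^[1+k]C2 k = trans
    (^-congʳ q (≡.trans (≡.sym (nCk+nC[k+1]≡[n+1]C[k+1] k 1)) (≡.cong (ℕ._+ (k C 2)) (nC1≡n k))))
    (^-homo-* q k (k C 2))

  -- The q-binomial formula for `e` with denominators cleared, valid in any commutative ring; `m`
  -- stands for n - k. The induction on n is the q-Pascal rule.
  e*pochhammer : ∀ n k m → k ℕ.+ m ≡ n →
    e n k * (pochhammer q k * pochhammer q m) ≈ q ^ (k C 2) * pochhammer q n
  e*pochhammer n zero m ≡.refl = *-congˡ (*-identityˡ _)
  -- Here every element is chosen: `e n (suc k)` vanishes, and `pochhammer q zero` has no last
  -- factor to split off.
  e*pochhammer (suc n) (suc k) zero eq = begin
    (e n (suc k) + q ^ n * e n k) * (pochhammer q (suc k) * 1#)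
      ≈⟨ *-cong (+-congʳ (e-vanish {n} (s≤s (ℕ.≤-reflexive (≡.sym k≡n))))) (*-congʳ (pochhammer-suc q k)) ⟩
    (0# + q ^ n * e n k) * ((pochhammer q k * (1# - q * q ^ k)) * 1#)
      ≈⟨ solve 4 (λ p b P x → (con 0 :+ p :* b) :* ((P :* x) :* con 1) := (p :* (b :* (P :* con 1))) :* x)
           refl (q ^ n) (e n k) (pochhammer q k) (1# - q * q ^ k) ⟩
    (q ^ n * (e n k * (pochhammer q k * 1#))) * (1# - q * q ^ k)
      ≈⟨ *-cong (*-cong (^-congʳ q (≡.sym k≡n)) (e*pochhammer n k zero (ℕ.suc-injective eq)))
           (+-congˡ (-‿cong (*-congˡ (^-congʳ q k≡n)))) ⟩
    (q ^ k * (q ^ (k C 2) * pochhammer q n)) * (1# - q * q ^ n)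
      ≈⟨ solve 4 (λ p c P x → (p :* (c :* P)) :* x := (p :* c) :* (P :* x))
           refl (q ^ k) (q ^ (k C 2)) (pochhammer q n) (1# - q * q ^ n) ⟩
    (q ^ k * q ^ (k C 2)) * (pochhammer q n * (1# - q * q ^ n))
      ≈⟨ *-cong (q^[1+k]C2 k) (pochhammer-suc q n) ⟨
    q ^ (suc k C 2) * pochhammer q (suc n) ∎
    where
    k≡n : k ≡ n
    k≡n = ≡.trans (≡.sym (ℕ.+-identityʳ k)) (ℕ.suc-injective eq)
  e*pochhammer (suc n) (suc k) (suc m) eq = begin
    (e n (suc k) + q ^ n * e n k) * (pochhammer q (suc k) * pochhammer q (suc m))
      ≈⟨ solve 5 (λ A p B K M → (A :+ p :* B) :* (K :* M) := A :* (K :* M) :+ p :* (B :* (K :* M)))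
           refl (e n (suc k)) (q ^ n) (e n k) (pochhammer q (suc k)) (pochhammer q (suc m)) ⟩
    e n (suc k) * (pochhammer q (suc k) * pochhammer q (suc m))
      + q ^ n * (e n k * (pochhammer q (suc k) * pochhammer q (suc m)))
      -- Each summand sheds the factor that separates it from an induction hypothesis: `y` for the
      -- pair (k+1, m), `x` for (k, m+1). Splitting qⁿ frees q^k to raise the exponent of q from k
      -- choose 2 to k+1 choose 2.
      ≈⟨ +-cong (*-congˡ (*-congˡ (pochhammer-suc q m)))
           (*-cong q^n (*-congˡ (*-congʳ (pochhammer-suc q k)))) ⟩
    e n (suc k) * (pochhammer q (suc k) * (pochhammer q m * y))
      + (q ^ k * q ^ suc m) * (e n k * ((pochhammer q k * x) * pochhammer q (suc m)))
      ≈⟨ +-cong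
           (solve 4 (λ A K M y → A :* (K :* (M :* y)) := (A :* (K :* M)) :* y)
             refl (e n (suc k)) (pochhammer q (suc k)) (pochhammer q m) y)
           (solve 5 (λ p B K x M → p :* (B :* ((K :* x) :* M)) := p :* (B :* (K :* M)) :* x)
             refl (q ^ k * q ^ suc m) (e n k) (pochhammer q k) x (pochhammer q (suc m))) ⟩
    (e n (suc k) * (pochhammer q (suc k) * pochhammer q m)) * y
      + (q ^ k * q ^ suc m) * (e n k * (pochhammer q k * pochhammer q (suc m))) * x
      ≈⟨ +-cong
           (*-congʳ (trans (e*pochhammer n (suc k) m (≡.trans (≡.sym (ℕ.+-suc k m)) (ℕ.suc-injective eq)))
                           (*-congʳ (q^[1+k]C2 k))))
           (*-congʳ (*-congˡ (e*pochhammer n k (suc m) (ℕ.suc-injective eq)))) ⟩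
    ((q ^ k * q ^ (k C 2)) * pochhammer q n) * y
      + (q ^ k * q ^ suc m) * (q ^ (k C 2) * pochhammer q n) * x
      ≈⟨ solve 6 (λ p c P y z x → ((p :* c) :* P) :* y :+ (p :* z) :* (c :* P) :* x
                                  := (p :* c) :* (P :* (y :+ z :* x)))
           refl (q ^ k) (q ^ (k C 2)) (pochhammer q n) y (q ^ suc m) x ⟩
    (q ^ k * q ^ (k C 2)) * (pochhammer q n * (y + q ^ suc m * x))
      -- The bracket collapses to 1 - q^(n+1), the last factor of `pochhammer q (suc n)`.
      ≈⟨ *-cong (sym (q^[1+k]C2 k)) (*-congˡ (trans (1-y+y[1-x] (q ^ suc k) (q ^ suc m))
           (+-congˡ (-‿cong q^[1+n])))) ⟩
    q ^ (suc k C 2) * (pochhammer q n * (1# - q * q ^ n))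
      ≈⟨ *-congˡ (pochhammer-suc q n) ⟨
    q ^ (suc k C 2) * pochhammer q (suc n) ∎
    where
    x y : Carrier
    x = 1# - q * q ^ k
    y = 1# - q * q ^ m
    q^n : q ^ n ≈ q ^ k * q ^ suc m
    q^n = trans (^-congʳ q (≡.sym (ℕ.suc-injective eq))) (^-homo-* q k (suc m))
    q^[1+n] : q ^ suc k * q ^ suc m ≈ q * q ^ n
    q^[1+n] = trans (*-assoc q (q ^ k) (q ^ suc m)) (*-congˡ (sym q^n))

  -- Turns a cross-multiplied identity back into a quotient, with `i` as the inverse of `d`.
  *-quotient : ∀ {a b c d i} → a * d ≈ c * b → d * i ≈ 1# → (b * i) * c ≈ a
  *-quotient {a} {b} {c} {d} {i} ad≈cb di≈1 = begin
    (b * i) * c ≈⟨ solve 3 (λ b i c → (b :* i) :* c := (c :* b) :* i) refl b i c ⟩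
    (c * b) * i ≈⟨ *-congʳ ad≈cb ⟨
    (a * d) * i ≈⟨ *-assoc a d i ⟩
    a * (d * i) ≈⟨ *-congˡ di≈1 ⟩
    a * 1#      ≈⟨ *-identityʳ a ⟩
    a           ∎

-- Specialisation to the complex numbers.

open import Defs

open CommutativeRing ℂ-Ring.commutativeRing using (sym; trans; *-congʳ; +-monoid)
open import Algebra.Properties.Monoid.Sum +-monoid using (sum-cong-≋)
open import Algebra.Properties.Monoid.Mult +-monoid using (×-congʳ)
open ElementarySymmetric ℂ-Ring.commutativeRing

qBinomial≈e : ∀ q (q<1 : ∣ q ∣ <ᴿ 1ᴿ) n (k : Fin (suc n)) →
  qBinomial q q<1 n k * q ^ (toℕ k C 2) ≈ e q n (toℕ k)
qBinomial≈e q q<1 n k = *-quotient q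
  (e*pochhammer q n (toℕ k) (n ∸ toℕ k) (ℕ.m+[n∸m]≡n (ℕ.≤-pred (toℕ<n k))))
  (⁻¹-inverseʳ (⟨ q ⨾ q ⟩ (toℕ k) * ⟨ q ⨾ q ⟩ (n ∸ toℕ k)) (⟨q⨾q⟩*⟨q⨾q⟩#0 q q<1 (toℕ k) (n ∸ toℕ k)))

theorem2p3 : (q : ℂ) → 0ᴿ <ᴿ ∣ q ∣ → (∣q∣<1 : ∣ q ∣ <ᴿ 1ᴿ) →
    (n : ℕ) → n ≥ 1 →
    (a x : ℂ) → (axqᵏ#1 : (k : Fin n) → a * x * q ^ toℕ k # 1ℂ) →
    ∑[ i < n ]
    (let k = suc i in
    toℕ k · (qBinomial q ∣q∣<1 n k * q ^ (toℕ k C 2) * (- (a * x)) ^ (toℕ k ∸ 1)))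
    ≈ ⟨ a * x ⨾ q ⟩ n *
    (∑[ k < n ] (q ^ toℕ k / (1ℂ - a * x * q ^ toℕ k) [ #1⇒1-#0 (a * x * q ^ toℕ k) (axqᵏ#1 k) ]))
theorem2p3 q _ ∣q∣<1 n _ a x axqᵏ#1 = trans
  -- With k = i + 1 the exponent `toℕ k ∸ 1` computes to `toℕ i`, so replacing the q-binomial
  -- factors by `e` turns the left side into `deriv n` at t = ax.
  (sum-cong-≋ {n} λ i → ×-congʳ (suc (toℕ i)) (*-congʳ (qBinomial≈e q ∣q∣<1 n (suc i))))
  (sym (pochhammer*∑≈deriv q (a * x) n _ λ k →
    ⁻¹-inverseʳ (1ℂ - a * x * q ^ toℕ k) (#1⇒1-#0 (a * x * q ^ toℕ k) (axqᵏ#1 k))))
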